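{- Let $G$ be a graph on $n$ vertices. Then for every $q \in [0,1]$, $G$ contains one of the following: (i) a relatively $q$-full subgraph on $\lceil qn \rceil$ vertices, or (ii) a relatively $(1-q)$-full subgraph on $\lfloor (1-q)n \rfloor$ vertices, or (iii) a relatively $q$-full subgraph on $\lceil qn \rceil + 1$ vertices and a relatively $(1-q)$-full subgraph on $\lfloor (1-q)n \rfloor + 1$ vertices.
   Context: Graphs are finite and simple. For $q \in [0,1]$, a subgraph $H$ of a graph $G$ is relatively $q$-full if $d_H(v) \geq q\, d_G(v)$ for all $v \in V(H)$, where $d_H(v)$ and $d_G(v)$ denote the degrees of $v$ in $H$ and $G$. (The empty subgraph on $0$ vertices satisfies this vacuously.) -}

module Defs where

open import Algebra.Bundles.Raw using (RawMonoid)
import Algebra.Definitions.RawMonoid as RawMonoidDefs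
import Algebra.Properties.Group as GroupProperties
open import Data.Fin.Base using (Fin)
open import Data.Fin.Subset using (Subset; _∈_; ∣_∣)
open import Data.Integer.Base as ℤ using (ℤ; +_)
open import Data.Nat.Base using (ℕ)
open import Data.Product.Base using (_×_; _,_; ∃-syntax; Σ-syntax)
open import Data.Rational.Base as ℚ using (ℚ; 0ℚ; 1ℚ; _<_)
open import Data.Rational.Literals using (fromℤ)
import Data.Rational.Properties as ℚ
open import Data.Vec.Base using (tabulate)
open import Function.Base using (_∘_)
open import Level using (0ℓ)
open import Relation.Binary.Core using (Rel; _⇒_)
open import Relation.Binary.Definitions
  using (Decidable; Symmetric; Irreflexive; tri<; tri≈; tri>)
open import Relation.Binary.PropositionalEquality
  using (_≡_; refl; sym; trans; cong; subst; subst₂)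
open import Relation.Nullary using (¬_; does; contradiction)
open import Relation.Unary using (Pred)

-- A real number is a Dedekind cut in the classical one-sided form: a nonempty
-- proper lower set of rationals without a greatest element.  Classically these
-- are all the real numbers; constructively they need not be located, so results
-- about them are meant to be read under excluded middle.

record ℝ : Set₁ where
  field
    Lower     : Pred ℚ 0ℓ
    inhabited : ∃[ r ] Lower r
    bounded   : ∃[ r ] ¬ Lower r
    downward  : ∀ {r s} → r < s → Lower s → Lower r
    rounded   : ∀ {r} → Lower r → ∃[ s ] r < s × Lower s

  lower<upper : ∀ {r s} → Lower r → ¬ Lower s → r < s
  lower<upper {r} {s} r∈ s∉ with ℚ.<-cmp r s
  ... | tri< r<s _ _  = r<s
  ... | tri≈ _ refl _ = contradiction r∈ s∉
  ... | tri> _ _ s<r  = contradiction (downward s<r r∈) s∉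

open ℝ

private
  open GroupProperties ℚ.+-0-group using (⁻¹-involutive)

  r-1<r : ∀ r → r ℚ.+ ℚ.- 1ℚ < r
  r-1<r r = subst (r ℚ.+ ℚ.- 1ℚ <_) (ℚ.+-identityʳ r)
                  (ℚ.+-monoʳ-< r (ℚ.negative⁻¹ (ℚ.- 1ℚ)))

  r+[s-r]≡s : ∀ r s → r ℚ.+ (s ℚ.- r) ≡ s
  r+[s-r]≡s r s = trans (cong (r ℚ.+_) (ℚ.+-comm s (ℚ.- r)))
                 (trans (sym (ℚ.+-assoc r (ℚ.- r) s))
                 (trans (cong (ℚ._+ s) (ℚ.+-inverseʳ r)) (ℚ.+-identityˡ s)))

  [r+s]-r≡s : ∀ r s → (r ℚ.+ s) ℚ.- r ≡ s
  [r+s]-r≡s r s = trans (ℚ.+-assoc r s (ℚ.- r)) (r+[s-r]≡s r s)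

  neg-cancel-< : ∀ {r s} → ℚ.- r < ℚ.- s → s < r
  neg-cancel-< {r} {s} p =
    subst₂ _<_ (⁻¹-involutive s) (⁻¹-involutive r) (ℚ.neg-antimono-< p)

fromℚ : ℚ → ℝ
fromℚ q = record
  { Lower     = _< q
  ; inhabited = q ℚ.+ ℚ.- 1ℚ , r-1<r q
  ; bounded   = q , ℚ.<-irrefl refl
  ; downward  = ℚ.<-trans
  ; rounded   = ℚ.<-dense
  }

ℤ→ℝ : ℤ → ℝ
ℤ→ℝ = fromℚ ∘ fromℤ

ℕ→ℝ : ℕ → ℝ
ℕ→ℝ n = ℤ→ℝ (+ n)

0ℝ 1ℝ : ℝ
0ℝ = fromℚ 0ℚ
1ℝ = fromℚ 1ℚ

infix 4 _≤ℝ_ _≈ℝ_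

_≤ℝ_ : Rel ℝ 0ℓ
x ≤ℝ y = ∀ r → Lower x r → Lower y r

_≈ℝ_ : Rel ℝ 0ℓ
x ≈ℝ y = x ≤ℝ y × y ≤ℝ x

infixl 6 _+ℝ_ _-ℝ_
infix  8 -ℝ_

_+ℝ_ : ℝ → ℝ → ℝ
x +ℝ y = record
  { Lower     = λ t → ∃[ r ] ∃[ s ] Lower x r × Lower y s × t ≡ r ℚ.+ s
  ; inhabited = let r , r∈ = inhabited x ; s , s∈ = inhabited y
                in r ℚ.+ s , r , s , r∈ , s∈ , refl
  ; bounded   = let b , b∉ = bounded x ; c , c∉ = bounded y
                in b ℚ.+ c , λ { (r , s , r∈ , s∈ , eq) →
                     ℚ.<-irrefl (sym eq)
                       (ℚ.+-mono-< (lower<upper x r∈ b∉) (lower<upper y s∈ c∉)) }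
  ; downward  = λ { {t} t<r+s (r , s , r∈ , s∈ , refl) →
                    r , t ℚ.- r , r∈ ,
                    downward y
                      (subst (t ℚ.- r <_) ([r+s]-r≡s r s)
                             (ℚ.+-monoˡ-< (ℚ.- r) t<r+s))
                      s∈ ,
                    sym (r+[s-r]≡s r t) }
  ; rounded   = λ { (r , s , r∈ , s∈ , refl) →
                    let s′ , s<s′ , s′∈ = rounded y s∈
                    in r ℚ.+ s′ , ℚ.+-monoʳ-< r s<s′ , r , s′ , r∈ , s′∈ , refl }
  }

-- The negatives of the rationals outside the cut may have a greatest element,
-- hence the strict inequality.

-ℝ_ : ℝ → ℝ
-ℝ x = record
  { Lower     = λ r → ∃[ s ] ¬ Lower x s × r < ℚ.- s
  ; inhabited = let s , s∉ = bounded x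
                in ℚ.- s ℚ.+ ℚ.- 1ℚ , s , s∉ , r-1<r (ℚ.- s)
  ; bounded   = let r , r∈ = inhabited x
                in ℚ.- r , λ { (s , s∉ , -r<-s) →
                     s∉ (downward x (neg-cancel-< -r<-s) r∈) }
  ; downward  = λ { r<r′ (s , s∉ , r′<-s) → s , s∉ , ℚ.<-trans r<r′ r′<-s }
  ; rounded   = λ { (s , s∉ , r<-s) →
                    let t , r<t , t<-s = ℚ.<-dense r<-s
                    in t , r<t , s , s∉ , t<-s }
  }

_-ℝ_ : ℝ → ℝ → ℝ
x -ℝ y = x +ℝ (-ℝ y)

+-ℝ-rawMonoid : RawMonoid _ _
+-ℝ-rawMonoid = record { Carrier = ℝ ; _≈_ = _≈ℝ_ ; _∙_ = _+ℝ_ ; ε = 0ℝ }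

-- Only products of a real with a natural number occur, so the product is taken
-- to be the iterated sum.

open RawMonoidDefs +-ℝ-rawMonoid public using () renaming (_×_ to _·_)

IsCeiling : ℝ → ℤ → Set
IsCeiling x k = x ≤ℝ ℤ→ℝ k × (∀ j → x ≤ℝ ℤ→ℝ j → k ℤ.≤ j)

IsFloor : ℝ → ℤ → Set
IsFloor x k = ℤ→ℝ k ≤ℝ x × (∀ j → ℤ→ℝ j ≤ℝ x → j ℤ.≤ k)

record Graph (n : ℕ) : Set₁ where
  field
    Adj        : Rel (Fin n) 0ℓ
    adj?       : Decidable Adj
    adj-sym    : Symmetric Adj
    adj-irrefl : Irreflexive _≡_ Adj

  neighbours : Fin n → Subset n
  neighbours v = tabulate (does ∘ adj? v)

  degree : Fin n → ℕ
  degree v = ∣ neighbours v ∣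

-- A subgraph need not be induced.  Its edges are kept as a graph on the vertices
-- of G in which only members of the chosen vertex set may have neighbours.

record Subgraph {n} (G : Graph n) : Set₁ where
  field
    vertices  : Subset n
    edges     : Graph n
    edges⊆G   : Graph.Adj edges ⇒ Graph.Adj G
    endpoint∈ : ∀ {u v} → Graph.Adj edges u v → u ∈ vertices

  order : ℕ
  order = ∣ vertices ∣

  open Graph edges public using (degree)

module _ {n} {G : Graph n} where

  RelativelyFull : ℝ → Subgraph G → Set
  RelativelyFull q H =
    ∀ v → v ∈ Subgraph.vertices H →
    Graph.degree G v · q ≤ℝ ℕ→ℝ (Subgraph.degree H v)

HasRelativelyFull : ∀ {n} → Graph n → ℝ → ℕ → Set₁
HasRelativelyFull G q k =
  Σ[ H ∈ Subgraph G ] Subgraph.order H ≡ k × RelativelyFull q H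

{-# OPTIONS --safe #-}
module Submission where

-- Only finitely many comparisons of q d with m (d, m ≤ n) matter, so q may be
-- replaced by a rational p < q close enough to it: then p-fullness implies
-- q-fullness, and (1 - p)-fullness implies (1 - q)-fullness because p < q.
-- For a vertex set A put g(v) = d_A(v) - p d(v), and let A maximise
-- e(A) - p Σ_{v ∈ A} d(v) among the sets of size k = n - l.  If A does not induce
-- a p-full subgraph and its complement not a (1 - p)-full one, there are x ∈ A with
-- g(x) < 0 and y ∉ A with g(y) > 0.  Exchanging any u ∈ A for any v ∉ A changes the
-- maximised quantity by g(v) - g(u) - [uv ∈ E], so g(v) - g(u) ≤ [uv ∈ E].  Taking
-- v = y shows that A ∪ {y} is p-full, taking u = x that the complement of A \ {x}
-- is (1 - p)-full.

open import Defs
open import Axiom.ExcludedMiddle using (ExcludedMiddle)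
open import Data.Integer.Base using (+_)
open import Data.Nat.Base using (ℕ; suc)
open import Data.Product.Base using (_×_)
open import Data.Sum.Base using (_⊎_)
open import Level using (0ℓ)

open import Algebra.Bundles using (module CommutativeRing)
import Algebra.Properties.Semiring.Sum as SemiringSum
open import Data.Bool.Base using (Bool; true; false; if_then_else_; not)
import Data.Bool.Properties as Bool
open import Data.Fin.Base using (Fin; zero; suc)
import Data.Fin.Properties as Fin
open import Data.Fin.Subset
  using (Subset; inside; outside; ∣_∣; _∈_; _∉_; ⊥; ∁)
open import Data.Fin.Subset.Properties
  using (∣⊥∣≡0; ∣p∣≤n; ∣∁p∣≡n∸∣p∣; x∈∁p⇒x∉p; x∉p⇒x∈∁p; _∈?_)
open import Data.Integer.Base as ℤ using (ℤ)
import Data.Integer.Properties as ℤ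
open import Data.Integer.Solver using () renaming (module +-*-Solver to ℤSolver)
open import Data.List.Base as List using (List; []; _∷_; _++_; filter; cartesianProduct; upTo)
import Data.List.Extrema as Extrema
open import Data.List.Membership.Propositional as List using ()
open import Data.List.Membership.Propositional.Properties
  using (∈-++⁺ˡ; ∈-++⁺ʳ; ∈-map⁺; ∈-filter⁺; ∈-cartesianProduct⁺; ∈-upTo⁺)
open import Data.List.Relation.Unary.All as All using (All; []; _∷_)
open import Data.List.Relation.Unary.All.Properties using (all-filter)
open import Data.List.Relation.Unary.Any using (here)
open import Data.Nat.Base as ℕ using (zero; _∸_; z≤n; s≤s)
import Data.Nat.Properties as ℕ
open import Data.Product.Base using (_,_; ∃-syntax; proj₁; proj₂)
open import Data.Rational.Base as ℚ
  using (ℚ; 0ℚ; 1ℚ; _+_; _*_; -_; _-_; _<_; _≤_; _⊔_; 1/_; NonNegative)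
open import Data.Rational.Literals using (fromℤ)
import Data.Rational.Properties as ℚ
open import Data.Rational.Solver using (module +-*-Solver)
open import Data.Sum.Base as Sum using (inj₁; inj₂)
open import Data.Vec.Base using ([]; _∷_; lookup; _[_]≔_; here; there)
open import Data.Vec.Properties
  using ([]=⇒lookup; lookup⇒[]=; lookup∘tabulate; lookup∘updateAt′; lookup-map)
open import Function.Base using (_∘_)
open import Function.Bundles using (mk⇔)
open import Relation.Binary.Bundles using (module DecTotalOrder)
open import Relation.Binary.PropositionalEquality
open import Relation.Nullary using (¬_; Dec; yes; no; does; contradiction)
open import Relation.Nullary.Decidable using (_×-dec_; ¬?; dec-false; does-⇔)

open ℝ
open SemiringSum (CommutativeRing.semiring ℚ.+-*-commutativeRing)
  using (sum; ∑-distrib-+; *-distribˡ-sum; sum-cong-≗; sum-replicate-zero; sum-syntax)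
open ℤSolver using () renaming (_:=_ to _⊜_; _:+_ to _⊕_; _:-_ to _⊖_)
open +-*-Solver using (solve; _:=_; _:+_; _:*_; :-_; _:-_; con)

-- Rational arithmetic

p≤q⇒0≤q-p : ∀ {p q} → p ≤ q → 0ℚ ≤ q - p
p≤q⇒0≤q-p {p} {q} p≤q = subst (_≤ q - p) (ℚ.+-inverseʳ p) (ℚ.+-monoˡ-≤ (- p) p≤q)

0≤q-p⇒p≤q : ∀ {p q} → 0ℚ ≤ q - p → p ≤ q
0≤q-p⇒p≤q {p} {q} h =
  subst₂ _≤_ (ℚ.+-identityˡ p)
    (solve 2 (λ q p → q :- p :+ p := q) refl q p) (ℚ.+-monoˡ-≤ p h)

p<q⇒0<q-p : ∀ {p q} → p < q → 0ℚ < q - p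
p<q⇒0<q-p {p} {q} p<q = subst (_< q - p) (ℚ.+-inverseʳ p) (ℚ.+-monoˡ-< (- p) p<q)

0<q-p⇒p<q : ∀ {p q} → 0ℚ < q - p → p < q
0<q-p⇒p<q {p} {q} h =
  subst₂ _<_ (ℚ.+-identityˡ p)
    (solve 2 (λ q p → q :- p :+ p := q) refl q p) (ℚ.+-monoˡ-< p h)

-- The equality of differences is an identity for the ring solver.
≤-by : ∀ {p q r s} → q - p ≡ s - r → p ≤ q → r ≤ s
≤-by eq p≤q = 0≤q-p⇒p≤q (subst (0ℚ ≤_) eq (p≤q⇒0≤q-p p≤q))

<-by : ∀ {p q r s} → q - p ≡ s - r → p < q → r < s
<-by eq p<q = 0<q-p⇒p<q (subst (0ℚ <_) eq (p<q⇒0<q-p p<q))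

≤⇒≯ : ∀ {p q} → p ≤ q → ¬ q < p
≤⇒≯ p≤q q<p = ℚ.<-irrefl refl (ℚ.<-≤-trans q<p p≤q)

fromℤ≡/1 : ∀ i → fromℤ i ≡ i ℚ./ 1
fromℤ≡/1 i = sym (ℚ.↥p/↧p≡p (fromℤ i))

fromℤ-homo-+ : ∀ i j → fromℤ (i ℤ.+ j) ≡ fromℤ i + fromℤ j
fromℤ-homo-+ i j = trans (fromℤ≡/1 (i ℤ.+ j))
  (cong (ℚ._/ 1) (sym (cong₂ ℤ._+_ (ℤ.*-identityʳ i) (ℤ.*-identityʳ j))))

fromℤ-homo-neg : ∀ i → fromℤ (ℤ.- i) ≡ - fromℤ i
fromℤ-homo-neg (+ 0)        = refl
fromℤ-homo-neg (+ suc _)    = refl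
fromℤ-homo-neg (ℤ.-[1+ _ ]) = refl

fromℤ-homo-- : ∀ i j → fromℤ (i ℤ.- j) ≡ fromℤ i - fromℤ j
fromℤ-homo-- i j = trans (fromℤ-homo-+ i (ℤ.- j)) (cong (λ e → fromℤ i + e) (fromℤ-homo-neg j))

ι : ℕ → ℚ
ι m = fromℤ (+ m)

ι-suc : ∀ m → ι (suc m) ≡ 1ℚ + ι m
ι-suc m = fromℤ-homo-+ (+ 1) (+ m)

instance
  ι-nonNeg : ∀ {m} → NonNegative (ι m)
  ι-nonNeg = _

-- Cuts

module _ (x : ℝ) where

  -- Splitting off one copy of `r` from `t` leaves the gap between `t` and `ι d * r` unchanged, so
  -- the strict inequality survives down to `d = 0`, where it reads `t < 0ℚ`.
  ·-Lower⁺ : ∀ d {r t} → Lower x r → t < ι d * r → Lower (d · x) t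
  ·-Lower⁺ zero {r} r∈ t< = subst (_ <_) (ℚ.*-zeroˡ r) t<
  ·-Lower⁺ (suc d) {r} {t} r∈ t< =
    r , t - r , r∈ ,
    ·-Lower⁺ d r∈ (<-by eq t<) ,
    solve 2 (λ t r → t := r :+ (t :- r)) refl t r
    where
    eq : ι (suc d) * r - t ≡ ι d * r - (t - r)
    eq = trans (cong (λ e → e * r - t) (ι-suc d))
      (solve 3 (λ d r t → (con 1ℚ :+ d) :* r :- t := d :* r :- (t :- r)) refl (ι d) r t)

  -- The iterated sum may use a different rational of the cut for each copy of `x`; the maximum of
  -- them stays in the cut and serves for all copies.
  ·-Lower⁻ : ∀ d {t} → Lower (d · x) t → ∃[ r ] Lower x r × t < ι d * r
  ·-Lower⁻ zero t<0 =
    let r , r∈ = inhabited x in r , r∈ , subst (_ <_) (sym (ℚ.*-zeroˡ r)) t<0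
  ·-Lower⁻ (suc d) (a , b , a∈ , b∈ , refl) =
    let r , r∈ , b<dr = ·-Lower⁻ d b∈
        m = a ⊔ r
        m∈ = ⊔-Lower a∈ r∈
    in m , m∈ ,
       subst (a + b <_)
         (trans (solve 2 (λ d m → m :+ d :* m := (con 1ℚ :+ d) :* m) refl (ι d) m)
                (cong (_* m) (sym (ι-suc d))))
         (ℚ.+-mono-≤-< (ℚ.p≤p⊔q a r)
           (ℚ.<-≤-trans b<dr (ℚ.*-monoˡ-≤-nonNeg (ι d) (ℚ.p≤q⊔p a r))))
    where
    ⊔-Lower : ∀ {a b} → Lower x a → Lower x b → Lower x (a ⊔ b)
    ⊔-Lower {a} {b} a∈ b∈ with ℚ.≤-total a b
    ... | inj₁ a≤b = subst (Lower x) (sym (ℚ.p≤q⇒p⊔q≡q a≤b)) b∈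
    ... | inj₂ b≤a = subst (Lower x) (sym (ℚ.p≥q⇒p⊔q≡p b≤a)) a∈

  ·-≤ℝ : ∀ d {m} → (∀ r → Lower x r → ι d * r ≤ fromℤ m) → d · x ≤ℝ ℤ→ℝ m
  ·-≤ℝ d h t t∈ = let r , r∈ , t< = ·-Lower⁻ d t∈ in ℚ.<-≤-trans t< (h r r∈)

module _ (x : ℝ) where

  1-Lower⁺ : ∀ {r s} → ¬ Lower x s → r < 1ℚ - s → Lower (1ℝ -ℝ x) r
  1-Lower⁺ {r} {s} s∉ r<1-s =
    -- Any `a` strictly between `r + s` and 1 splits `r` as required: `a < 1ℚ` and `r - a < - s`.
    let a , r+s<a , a<1 = ℚ.<-dense
          (<-by {r = r + s} (solve 2 (λ r s → con 1ℚ :- s :- r := con 1ℚ :- (r :+ s)) refl r s) r<1-s)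
    in a , r - a , a<1 ,
       (s , s∉ , <-by (solve 3 (λ a r s → a :- (r :+ s) := :- s :- (r :- a)) refl a r s) r+s<a) ,
       solve 2 (λ r a → r := a :+ (r :- a)) refl r a

  1-Lower⁻ : ∀ {p r} → Lower x p → Lower (1ℝ -ℝ x) r → r < 1ℚ - p
  1-Lower⁻ {p} p∈ (a , b , a<1 , (s , s∉ , b<-s) , refl) =
    ℚ.+-mono-< a<1 (ℚ.<-trans b<-s (ℚ.neg-antimono-< (lower<upper x p∈ s∉)))

  -- The pair stands for a degree in the whole graph and a degree in a subgraph.
  Determines : ℚ → ℕ × ℕ → Set
  Determines p (d , m) = ι d * p ≤ ι m → d · x ≤ℝ ℕ→ℝ m

  -- Raising `p` strengthens the premise, so approximations found for single pairs can be merged by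
  -- taking the larger one.
  determines-mono : ∀ {p p′} → p ≤ p′ → ∀ {dm} → Determines p dm → Determines p′ dm
  determines-mono p≤p′ {d , _} h dp′≤m =
    h (ℚ.≤-trans (ℚ.*-monoˡ-≤-nonNeg (ι d) p≤p′) dp′≤m)

  -- For each pair, either no `r` in the cut has `ι d * r` above `ι m`, and the conclusion holds
  -- outright, or some `r` does, and every `p` from `r` upwards refutes the premise. Excluded middle
  -- chooses between the two.
  determining : ExcludedMiddle 0ℓ → ∀ dms → ∃[ p ] Lower x p × All (Determines p) dms
  determining em [] = let p , p∈ = inhabited x in p , p∈ , []
  determining em ((d , m) ∷ dms) with determining em dms
  ... | p , p∈ , h with em {∃[ r ] Lower x r × ι m < ι d * r}
  ...   | no ¬r = p , p∈ , (λ _ → ·-≤ℝ x d λ r r∈ → ℚ.≮⇒≥ λ m<dr → ¬r (r , r∈ , m<dr)) ∷ h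
  ...   | yes (r , r∈ , m<dr) with ℚ.≤-total p r
  ...     | inj₁ p≤r = r , r∈ ,
              (λ dr≤m → contradiction m<dr (≤⇒≯ dr≤m)) ∷ All.map (λ {dm} → determines-mono p≤r {dm}) h
  ...     | inj₂ r≤p = p , p∈ ,
              (λ dp≤m → contradiction m<dr
                (≤⇒≯ (ℚ.≤-trans (ℚ.*-monoˡ-≤-nonNeg (ι d) r≤p) dp≤m))) ∷ h

  determining-≤ : ExcludedMiddle 0ℓ → ∀ n →
    ∃[ p ] Lower x p × (∀ {d m} → d ℕ.≤ n → m ℕ.≤ n → ι d * p ≤ ι m → d · x ≤ℝ ℕ→ℝ m)
  determining-≤ em n =
    let p , p∈ , h = determining em (cartesianProduct (upTo (suc n)) (upTo (suc n)))
    in p , p∈ , λ d≤n m≤n →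
         All.lookup h (∈-cartesianProduct⁺ (∈-upTo⁺ (s≤s d≤n)) (∈-upTo⁺ (s≤s m≤n)))

  -- As `p` lies in the cut of `x`, every rational in the cut of `1ℝ -ℝ x` is below `1ℚ - p`.
  1-·-≤ℝ : ∀ {p} d {m} → Lower x p → ι d * (1ℚ - p) ≤ fromℤ m → d · (1ℝ -ℝ x) ≤ℝ ℤ→ℝ m
  1-·-≤ℝ d p∈ h = ·-≤ℝ (1ℝ -ℝ x) d λ r r∈ →
    ℚ.≤-trans (ℚ.*-monoˡ-≤-nonNeg (ι d) (ℚ.<⇒≤ (1-Lower⁻ p∈ r∈))) h

  -- Ceiling and floor add up to n

  module _ {n k l} (k-ceil : IsCeiling (n · x) (+ k)) (l-floor : IsFloor (n · (1ℝ -ℝ x)) (+ l)) where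

    k≤n-l : + k ℤ.≤ + n ℤ.- + l
    k≤n-l = proj₂ k-ceil (+ n ℤ.- + l) (·-≤ℝ x n bound)
      where
      bound : ∀ r → Lower x r → ι n * r ≤ fromℤ (+ n ℤ.- + l)
      bound r r∈ = ℚ.≮⇒≥ λ n-l<nr →
        -- Being below `l`, this `u` belongs to `n · (1ℝ -ℝ x)` by the floor property; but
        -- everything there is below `ι n * (1ℚ - r)`, and `u` is above it.
        let u , n[1-r]<u , u<l = ℚ.<-dense {ι n * (1ℚ - r)} {ι l}
              (<-by (solve 3 (λ n r l → n :* r :- (n :- l) := l :- n :* (con 1ℚ :- r)) refl (ι n) r (ι l))
                    (subst (_< ι n * r) (fromℤ-homo-- (+ n) (+ l)) n-l<nr))
            r′ , r′∈ , u<nr′ = ·-Lower⁻ (1ℝ -ℝ x) n (proj₁ l-floor u u<l)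
        in ≤⇒≯ (ℚ.*-monoˡ-≤-nonNeg (ι n) (ℚ.<⇒≤ (1-Lower⁻ r∈ r′∈)))
                 (ℚ.<-trans n[1-r]<u u<nr′)

    n-k≤l : + n ℤ.- + k ℤ.≤ + l
    n-k≤l = proj₂ l-floor (+ n ℤ.- + k) λ u u< →
      below n (proj₁ k-ceil) (subst (u <_) (fromℤ-homo-- (+ n) (+ k)) u<)
      where
      below : ∀ n {u} → n · x ≤ℝ ℤ→ℝ (+ k) → u < ι n - ι k → Lower (n · (1ℝ -ℝ x)) u
      -- The general case divides by `n`. Here the multiple is zero, and `u` is below `- ι k`, hence
      -- negative.
      below zero {u} _ u< = ℚ.<-≤-trans u<
        (subst (_≤ 0ℚ) (sym (ℚ.+-identityˡ (- ι k))) (ℚ.neg-antimono-≤ (ℚ.nonNegative⁻¹ (ι k))))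
      below n@(suc _) nx≤k u< =
        -- Two intermediate points: `w` below `N - ι k` keeps `1ℚ - w * ρ` out of the cut of `x`,
        -- and `v` below `w` gives the strict inequality that membership in a negated cut demands.
        let w , u<w , w< = ℚ.<-dense u<
            v , u<v , v<w = ℚ.<-dense u<w
        in ·-Lower⁺ (1ℝ -ℝ x) n
             (1-Lower⁺ (w∉ w<) (<-by (eq₁ v w) (ℚ.*-monoˡ-<-pos ρ v<w)))
             (subst (_ <_) (sym (N*[·ρ] v)) u<v)
        where
        N = ι n
        ρ = 1/ N
        N*[·ρ] : ∀ v → N * (v * ρ) ≡ v
        N*[·ρ] v = trans (solve 3 (λ n v r → n :* (v :* r) := v :* (n :* r)) refl N v ρ)
          (trans (cong (v *_) (ℚ.*-inverseʳ N)) (ℚ.*-identityʳ v))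
        eq₁ : ∀ v w → w * ρ - v * ρ ≡ 1ℚ - (1ℚ - w * ρ) - v * ρ
        eq₁ v w = solve 2 (λ v w → w :- v := con 1ℚ :- (con 1ℚ :- w) :- v) refl (v * ρ) (w * ρ)
        w∉ : ∀ {w} → w < N - ι k → ¬ Lower x (1ℚ - w * ρ)
        w∉ {w} w< s∈ =
          -- Roundedness puts `N * (1ℚ - w * ρ)`, which is `N - w`, into `n · x` and so below `k`;
          -- the choice of `w` puts it above `k`.
          let s′ , s<s′ , s′∈ = rounded x s∈
          in ℚ.<-asym (nx≤k _ (·-Lower⁺ x n s′∈ (ℚ.*-monoʳ-<-pos N s<s′)))
               (<-by (trans (solve 3 (λ n k w → n :- k :- w := n :- w :- k) refl N (ι k) w)
                       (cong (_- ι k) (trans (cong (λ e → N - e) (sym (N*[·ρ] w)))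
                         (solve 2 (λ n v → n :- n :* v := n :* (con 1ℚ :- v)) refl N (w * ρ))))) w<)

    -- This lets one vertex partition serve both alternatives: the complement of a set of size `k`
    -- has size `l`.
    ceiling+floor : k ℕ.+ l ≡ n
    ceiling+floor = ℕ.≤-antisym
      (ℤ.drop‿+≤+ (subst (+ (k ℕ.+ l) ℤ.≤_)
        (ℤSolver.solve 2 (λ n l → n ⊖ l ⊕ l ⊜ n) refl (+ n) (+ l))
        (ℤ.+-monoˡ-≤ (+ l) k≤n-l)))
      (ℤ.drop‿+≤+ (subst (ℤ._≤ + (k ℕ.+ l))
        (ℤSolver.solve 2 (λ n k → k ⊕ (n ⊖ k) ⊜ n) refl (+ n) (+ k))
        (ℤ.+-monoʳ-≤ (+ k) n-k≤l)))

-- Subsets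

⟦_⟧ : Bool → ℚ
⟦ b ⟧ = if b then 1ℚ else 0ℚ

χ : ∀ {n} → Subset n → Fin n → ℚ
χ A i = ⟦ lookup A i ⟧

δ : ∀ {n} → Fin n → Fin n → ℚ
δ zero    zero    = 1ℚ
δ zero    (suc _) = 0ℚ
δ (suc _) zero    = 0ℚ
δ (suc x) (suc i) = δ x i

sum-δ : ∀ {n} (f : Fin n → ℚ) x → ∑[ i < n ] (f i * δ x i) ≡ f x
sum-δ {suc n} f zero = trans
  (cong₂ _+_ (ℚ.*-identityʳ (f zero))
    (trans (sum-cong-≗ (λ i → ℚ.*-zeroʳ (f (suc i)))) (sum-replicate-zero n)))
  (ℚ.+-identityʳ (f zero))
sum-δ f (suc x) = trans
  (cong₂ _+_ (ℚ.*-zeroʳ (f zero)) (sum-δ (f ∘ suc) x)) (ℚ.+-identityˡ (f (suc x)))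

-- The coefficient of `δ` is 1 for a genuine insertion and -1 for a genuine removal. In this form an
-- update adds a single term to any sum, by `sum-δ`.
χ-update : ∀ {n} (A : Subset n) x s i →
  χ (A [ x ]≔ s) i ≡ χ A i + (⟦ s ⟧ - χ A x) * δ x i
χ-update (a ∷ A) zero    s zero    =
  solve 2 (λ s a → s := a :+ (s :- a) :* con 1ℚ) refl ⟦ s ⟧ ⟦ a ⟧
χ-update (a ∷ A) zero    s (suc i) =
  solve 2 (λ t c → c := c :+ t :* con 0ℚ) refl (⟦ s ⟧ - ⟦ a ⟧) (χ A i)
χ-update (a ∷ A) (suc x) s zero    =
  solve 2 (λ t c → c := c :+ t :* con 0ℚ) refl (⟦ s ⟧ - χ A x) ⟦ a ⟧
χ-update (a ∷ A) (suc x) s (suc i) = χ-update A x s i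

∣A∣≡sum-χ : ∀ {n} (A : Subset n) → ι ∣ A ∣ ≡ sum (χ A)
∣A∣≡sum-χ []            = refl
∣A∣≡sum-χ (outside ∷ A) = trans (∣A∣≡sum-χ A) (sym (ℚ.+-identityˡ (sum (χ A))))
∣A∣≡sum-χ (inside  ∷ A) = trans (ι-suc ∣ A ∣) (cong (λ e → 1ℚ + e) (∣A∣≡sum-χ A))

∈⇒χ≡1 : ∀ {n} {A : Subset n} {x} → x ∈ A → χ A x ≡ 1ℚ
∈⇒χ≡1 x∈A = cong ⟦_⟧ ([]=⇒lookup x∈A)

∉⇒χ≡0 : ∀ {n} {A : Subset n} {x} → x ∉ A → χ A x ≡ 0ℚ
∉⇒χ≡0 {A = A} {x} x∉A with lookup A x in eq
... | outside = refl
... | inside  = contradiction (lookup⇒[]= x A eq) x∉A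

∣insert∣ : ∀ {n} {A : Subset n} {x} → x ∉ A → ∣ A [ x ]≔ inside ∣ ≡ suc ∣ A ∣
∣insert∣ {A = outside ∷ A} {zero}  x∉A = refl
∣insert∣ {A = inside  ∷ A} {zero}  x∉A = contradiction here x∉A
∣insert∣ {A = outside ∷ A} {suc x} x∉A = ∣insert∣ (x∉A ∘ there)
∣insert∣ {A = inside  ∷ A} {suc x} x∉A = cong suc (∣insert∣ (x∉A ∘ there))

∣remove∣ : ∀ {n} {A : Subset n} {x} → x ∈ A → suc ∣ A [ x ]≔ outside ∣ ≡ ∣ A ∣
∣remove∣ {A = inside ∷ A}  here        = refl
∣remove∣ {A = outside ∷ A} (there x∈A) = ∣remove∣ x∈A
∣remove∣ {A = inside ∷ A}  (there x∈A) = cong suc (∣remove∣ x∈A)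

∈-update : ∀ {n} {A : Subset n} {x s v} → v ≢ x → v ∈ A [ x ]≔ s → v ∈ A
∈-update {A = A} {x} {v = v} v≢x v∈ =
  lookup⇒[]= v A (trans (sym (lookup∘updateAt′ v x v≢x A)) ([]=⇒lookup v∈))

∈-update⁺ : ∀ {n} {A : Subset n} {x s v} → v ≢ x → v ∈ A → v ∈ A [ x ]≔ s
∈-update⁺ {A = A} {x} {v = v} v≢x v∈ =
  lookup⇒[]= v _ (trans (lookup∘updateAt′ v x v≢x A) ([]=⇒lookup v∈))

subset-of-size : ∀ {n k} → k ℕ.≤ n → ∃[ A ] ∣_∣ {n} A ≡ k
subset-of-size {n} z≤n       = ⊥ , ∣⊥∣≡0 n
subset-of-size     (s≤s k≤n) = let A , ∣A∣≡k = subset-of-size k≤n in inside ∷ A , cong suc ∣A∣≡k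

subsets : ∀ n → List (Subset n)
subsets zero    = [] ∷ []
subsets (suc n) = List.map (outside ∷_) (subsets n) ++ List.map (inside ∷_) (subsets n)

∈-subsets : ∀ {n} (A : Subset n) → A List.∈ subsets n
∈-subsets []            = here refl
∈-subsets (outside ∷ A) = ∈-++⁺ˡ (∈-map⁺ _ (∈-subsets A))
∈-subsets (inside ∷ A)  = ∈-++⁺ʳ _ (∈-map⁺ _ (∈-subsets A))

maximal-subset : ∀ {n k} → k ℕ.≤ n → (f : Subset n → ℚ) →
  ∃[ A ] ∣ A ∣ ≡ k × (∀ B → ∣ B ∣ ≡ k → f B ≤ f A)
maximal-subset {n} {k} k≤n f =
  let A₀ , ∣A₀∣≡k = subset-of-size k≤n
  -- `argmax` may return its default, so `A₀` must itself have size `k`.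
  in argmax f A₀ candidates ,
     argmax-all f ∣A₀∣≡k (all-filter size? (subsets n)) ,
     λ B ∣B∣≡k → All.lookup (f[xs]≤f[argmax] A₀ candidates) (∈-filter⁺ size? (∈-subsets B) ∣B∣≡k)
  where
  open Extrema (DecTotalOrder.totalOrder ℚ.≤-decTotalOrder)
  size? : (A : Subset n) → Dec (∣ A ∣ ≡ k)
  size? A = ∣ A ∣ ℕ.≟ k
  candidates = filter size? (subsets n)

-- Exchange argument for weighted graphs

module Surplus {n} (w : Fin n → Fin n → ℚ) (c : Fin n → ℚ) where

  -- For `w` the adjacency matrix and `c v` equal to `p` times the degree of `v`, this is the `g` of
  -- the proof idea.
  surplus : Subset n → Fin n → ℚ
  surplus A v = ∑[ u < n ] (w v u * χ A u) - c v

  surplus-update : ∀ A x s v →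
    surplus (A [ x ]≔ s) v ≡ surplus A v + (⟦ s ⟧ - χ A x) * w v x
  surplus-update A x s v = trans
    (cong (_- c v) (trans
      (sum-cong-≗ λ u → trans (cong (w v u *_) (χ-update A x s u))
        (solve 4 (λ w a t d → w :* (a :+ t :* d) := w :* a :+ t :* w :* d) refl (w v u) (χ A u) t (δ x u)))
      (trans (∑-distrib-+ (λ u → w v u * χ A u) (λ u → t * w v u * δ x u))
        (cong (λ e → ∑[ u < n ] (w v u * χ A u) + e) (sum-δ (λ u → t * w v u) x)))))
    (solve 3 (λ a b c → a :+ b :- c := a :- c :+ b) refl (∑[ u < n ] (w v u * χ A u)) (t * w v x) (c v))
    where t = ⟦ s ⟧ - χ A x

  surplus-insert : ∀ {A y} v → y ∉ A → surplus (A [ y ]≔ inside) v ≡ surplus A v + w v y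
  surplus-insert {A} {y} v y∉A = trans (surplus-update A y inside v)
    (trans (cong (λ e → surplus A v + (1ℚ - e) * w v y) (∉⇒χ≡0 y∉A))
      (cong (λ e → surplus A v + e) (ℚ.*-identityˡ (w v y))))

  surplus-remove : ∀ {A x} v → x ∈ A → surplus (A [ x ]≔ outside) v ≡ surplus A v - w v x
  surplus-remove {A} {x} v x∈A = trans (surplus-update A x outside v)
    (trans (cong (λ e → surplus A v + (0ℚ - e) * w v x) (∈⇒χ≡1 x∈A))
      (solve 2 (λ g w → g :+ (con 0ℚ :- con 1ℚ) :* w := g :- w) refl (surplus A v) (w v x)))

  Deficit-free : Subset n → Set
  Deficit-free A = ∀ v → v ∈ A → 0ℚ ≤ surplus A v

  -- In the graph case this is fullness of the complement: at most `p d(v)` neighbours inside `A`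
  -- means at least `(1 - p) d(v)` outside.
  Excess-free : Subset n → Set
  Excess-free A = ∀ v → v ∉ A → surplus A v ≤ 0ℚ

module _ {n} (w : Fin n → Fin n → ℚ) (c : Fin n → ℚ) (w-sym : ∀ u v → w u v ≡ w v u)
         (w-diag : ∀ v → w v v ≡ 0ℚ) (w≥0 : ∀ u v → 0ℚ ≤ w u v) where

  open Surplus w c

  -- Up to the factor 2, the weight inside A minus the total of c over A; the
  -- surplus is its discrete derivative.
  potential : Subset n → ℚ
  potential A = ∑[ v < n ] (χ A v * (surplus A v - c v))

  -- The update affects row `x` and column `x` of the double sum. By symmetry of `w` they contribute
  -- equally, whence the factor 2, and the zero diagonal removes the term quadratic in `t`.
  potential-update : ∀ A x s → let t = ⟦ s ⟧ - χ A x in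
    potential (A [ x ]≔ s) ≡ potential A + (t * surplus A x + t * surplus A x)
  potential-update A x s = begin
    potential (A [ x ]≔ s)
      ≡⟨ sum-cong-≗ (λ v → trans
           (cong₂ (λ a b → a * (b - c v)) (χ-update A x s v) (surplus-update A x s v))
           (solve 6 (λ a t d g w c →
               (a :+ t :* d) :* (g :+ t :* w :- c)
               := a :* (g :- c) :+ (t :* (w :* a) :+ t :* (g :+ t :* w :- c) :* d))
             refl (χ A v) t (δ x v) (surplus A v) (w v x) (c v))) ⟩
    ∑[ v < n ] (χ A v * (surplus A v - c v) + (t * (w v x * χ A v) + f v * δ x v))
      ≡⟨ trans (∑-distrib-+ (λ v → χ A v * (surplus A v - c v)) _)
           (cong (λ e → potential A + e) (∑-distrib-+ (λ v → t * (w v x * χ A v)) (λ v → f v * δ x v))) ⟩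
    potential A + (∑[ v < n ] (t * (w v x * χ A v)) + ∑[ v < n ] (f v * δ x v))
      ≡⟨ cong (λ e → potential A + e) (cong₂ _+_
           (trans (sym (*-distribˡ-sum t (λ v → w v x * χ A v)))
                  (cong (t *_) (sum-cong-≗ λ v → cong (_* χ A v) (w-sym v x))))
           (trans (sum-δ f x) (cong (λ e → t * (surplus A x + t * e - c x)) (w-diag x)))) ⟩
    potential A + (t * S + t * (S - c x + t * 0ℚ - c x))
      ≡⟨ cong (λ e → potential A + e) (solve 3 (λ t S c →
           t :* S :+ t :* (S :- c :+ t :* con 0ℚ :- c)
           := t :* (S :- c) :+ t :* (S :- c)) refl t S (c x)) ⟩
    potential A + (t * surplus A x + t * surplus A x) ∎
    where
    open ≡-Reasoning
    t = ⟦ s ⟧ - χ A x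
    f = λ v → t * (surplus A v + t * w v x - c v)
    S = ∑[ u < n ] (w x u * χ A u)

  potential-insert : ∀ {A y} → y ∉ A →
    potential (A [ y ]≔ inside) ≡ potential A + (surplus A y + surplus A y)
  potential-insert {A} {y} y∉A = trans (potential-update A y inside)
    (trans (cong (λ e → potential A + ((1ℚ - e) * surplus A y + (1ℚ - e) * surplus A y)) (∉⇒χ≡0 y∉A))
      (solve 2 (λ p g → p :+ ((con 1ℚ :- con 0ℚ) :* g :+ (con 1ℚ :- con 0ℚ) :* g) := p :+ (g :+ g))
        refl (potential A) (surplus A y)))

  potential-remove : ∀ {A x} → x ∈ A →
    potential (A [ x ]≔ outside) ≡ potential A - (surplus A x + surplus A x)
  potential-remove {A} {x} x∈A = trans (potential-update A x outside)
    (trans (cong (λ e → potential A + ((0ℚ - e) * surplus A x + (0ℚ - e) * surplus A x)) (∈⇒χ≡1 x∈A))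
      (solve 2 (λ p g → p :+ ((con 0ℚ :- con 1ℚ) :* g :+ (con 0ℚ :- con 1ℚ) :* g) := p :- (g :+ g))
        refl (potential A) (surplus A x)))

  -- The surplus of `y` counts after `x` has left, which costs `w y x`. If the gap still exceeded
  -- this, the swapped set would have the same size and a larger potential.
  swap-bound : ∀ {k A} → ∣ A ∣ ≡ k → (∀ B → ∣ B ∣ ≡ k → potential B ≤ potential A) →
    ∀ {x y} → x ∈ A → y ∉ A → surplus A y - surplus A x ≤ w y x
  swap-bound {A = A} ∣A∣≡k max {x} {y} x∈A y∉A =
    ℚ.≮⇒≥ λ wyx<gap → ≤⇒≯ (max B ∣B∣≡k)
      (subst (potential A <_) (sym eq)
        (<-by (solve 4 (λ p w gx gy → (gy :- gx :+ (gy :- gx)) :- (w :+ w) :=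
                 p :- (gx :+ gx) :+ (gy :- w :+ (gy :- w)) :- p)
                refl (potential A) (w y x) (surplus A x) (surplus A y))
              (ℚ.+-mono-< wyx<gap wyx<gap)))
    where
    A-x = A [ x ]≔ outside
    B = A-x [ y ]≔ inside
    y∉A-x : y ∉ A-x
    y∉A-x = y∉A ∘ ∈-update (λ { refl → y∉A x∈A })
    ∣B∣≡k : ∣ B ∣ ≡ _
    ∣B∣≡k = trans (∣insert∣ y∉A-x) (trans (∣remove∣ x∈A) ∣A∣≡k)
    eq : potential B ≡ potential A - (surplus A x + surplus A x)
         + ((surplus A y - w y x) + (surplus A y - w y x))
    eq = trans (potential-insert y∉A-x)
      (cong₂ (λ a b → a + (b + b)) (potential-remove x∈A) (surplus-remove y x∈A))

  -- By the exchange bound, a member `v` of `A` ends with surplus `surplus A v + w v y`, at least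
  -- the positive `surplus A y`.
  insert-deficit-free : ∀ {A y} → y ∉ A → 0ℚ < surplus A y →
    (∀ {x} → x ∈ A → surplus A y - surplus A x ≤ w y x) →
    Deficit-free (A [ y ]≔ inside)
  insert-deficit-free {A} {y} y∉A 0<gy bound v v∈ =
    subst (0ℚ ≤_) (sym (surplus-insert v y∉A)) (nonneg (v Fin.≟ y))
    where
    nonneg : Dec (v ≡ y) → 0ℚ ≤ surplus A v + w v y
    nonneg (yes refl) = ℚ.+-mono-≤ (ℚ.<⇒≤ 0<gy) (w≥0 v v)
    nonneg (no v≢y) with 0ℚ ℚ.≤? surplus A v
    ... | yes 0≤gv = ℚ.+-mono-≤ 0≤gv (w≥0 v y)
    ... | no  _    = ℚ.≤-trans (ℚ.<⇒≤ 0<gy)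
      (subst (λ e → surplus A y ≤ surplus A v + e) (w-sym y v)
        (≤-by (solve 3 (λ gy gv w → w :- (gy :- gv) := gv :+ w :- gy) refl (surplus A y) (surplus A v) (w y v))
              (bound (∈-update v≢y v∈))))

  -- Dually, a vertex outside `A` ends with surplus at most the negative `surplus A x`.
  remove-excess-free : ∀ {A x} → x ∈ A → surplus A x < 0ℚ →
    (∀ {y} → y ∉ A → surplus A y - surplus A x ≤ w y x) →
    Excess-free (A [ x ]≔ outside)
  remove-excess-free {A} {x} x∈A gx<0 bound v v∉ =
    subst (_≤ 0ℚ) (sym (surplus-remove v x∈A)) (nonpos (v Fin.≟ x))
    where
    -w≤0 : ∀ u → - w u x ≤ 0ℚ
    -w≤0 u = ℚ.neg-antimono-≤ (w≥0 u x)
    nonpos : Dec (v ≡ x) → surplus A v - w v x ≤ 0ℚ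
    nonpos (yes refl) = ℚ.+-mono-≤ (ℚ.<⇒≤ gx<0) (-w≤0 v)
    nonpos (no v≢x) with surplus A v ℚ.≤? 0ℚ
    ... | yes gv≤0 = ℚ.+-mono-≤ gv≤0 (-w≤0 v)
    ... | no  _    = ℚ.≤-trans
      (≤-by (solve 3 (λ gv gx w → w :- (gv :- gx) := gx :- (gv :- w)) refl (surplus A v) (surplus A x) (w v x))
            (bound (v∉ ∘ ∈-update⁺ v≢x)))
      (ℚ.<⇒≤ gx<0)

  -- Writing `suc ∣ A ∣ ≡ k` avoids truncated subtraction; `k` is positive there because a member of
  -- the maximising set is removed.
  surplus-trichotomy : ∀ {k} → k ℕ.≤ n →
    (∃[ A ] ∣ A ∣ ≡ k × Deficit-free A)
    ⊎ (∃[ A ] ∣ A ∣ ≡ k × Excess-free A)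
    ⊎ ((∃[ A ] ∣ A ∣ ≡ suc k × Deficit-free A) × (∃[ A ] suc ∣ A ∣ ≡ k × Excess-free A))
  surplus-trichotomy k≤n =
    let A , ∣A∣≡k , max = maximal-subset k≤n potential in
    cases A ∣A∣≡k max
      (Fin.any? (λ x → (x ∈? A) ×-dec (surplus A x ℚ.<? 0ℚ)))
      (Fin.any? (λ y → ¬? (y ∈? A) ×-dec (0ℚ ℚ.<? surplus A y)))
    where
    cases : ∀ {k} A → ∣ A ∣ ≡ k → (∀ B → ∣ B ∣ ≡ k → potential B ≤ potential A) →
      Dec (∃[ x ] x ∈ A × surplus A x < 0ℚ) → Dec (∃[ y ] y ∉ A × 0ℚ < surplus A y) →
      (∃[ A ] ∣ A ∣ ≡ k × Deficit-free A)
      ⊎ (∃[ A ] ∣ A ∣ ≡ k × Excess-free A)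
      ⊎ ((∃[ A ] ∣ A ∣ ≡ suc k × Deficit-free A) × (∃[ A ] suc ∣ A ∣ ≡ k × Excess-free A))
    cases A ∣A∣≡k _ (no ¬x) _ = inj₁ (A , ∣A∣≡k , λ v v∈A → ℚ.≮⇒≥ λ gv<0 → ¬x (v , v∈A , gv<0))
    cases A ∣A∣≡k _ (yes _) (no ¬y) =
      inj₂ (inj₁ (A , ∣A∣≡k , λ v v∉A → ℚ.≮⇒≥ λ 0<gv → ¬y (v , v∉A , 0<gv)))
    cases A ∣A∣≡k max (yes (x , x∈A , gx<0)) (yes (y , y∉A , 0<gy)) = inj₂ (inj₂
      ( (A [ y ]≔ inside , trans (∣insert∣ y∉A) (cong suc ∣A∣≡k) ,
         insert-deficit-free {A} y∉A 0<gy (λ x∈A → swap-bound {A = A} ∣A∣≡k max x∈A y∉A))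
      , (A [ x ]≔ outside , trans (∣remove∣ x∈A) ∣A∣≡k ,
         remove-excess-free {A} x∈A gx<0 (λ y∉A → swap-bound {A = A} ∣A∣≡k max x∈A y∉A))))

-- Graphs

module _ {n} (G : Graph n) where

  open Graph G

  -- Read off from `neighbours`, so that `∣A∣≡sum-χ` identifies a row sum with a degree.
  adjacency : Fin n → Fin n → ℚ
  adjacency u v = χ (neighbours u) v

  adjacency≡ : ∀ u v → adjacency u v ≡ ⟦ does (adj? u v) ⟧
  adjacency≡ u v = cong ⟦_⟧ (lookup∘tabulate (does ∘ adj? u) v)

  adjacency-sym : ∀ u v → adjacency u v ≡ adjacency v u
  adjacency-sym u v = trans (adjacency≡ u v)
    (trans (cong ⟦_⟧ (does-⇔ (mk⇔ adj-sym adj-sym) (adj? u v) (adj? v u))) (sym (adjacency≡ v u)))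

  adjacency-diag : ∀ v → adjacency v v ≡ 0ℚ
  adjacency-diag v = trans (adjacency≡ v v)
    (cong ⟦_⟧ (dec-false (adj? v v) (adj-irrefl refl)))

  adjacency≥0 : ∀ u v → 0ℚ ≤ adjacency u v
  adjacency≥0 u v with lookup (neighbours u) v
  ... | true  = ℚ.nonNegative⁻¹ 1ℚ
  ... | false = ℚ.≤-refl

  -- Membership is phrased through `lookup`, so that deciding an edge reduces to a Boolean case
  -- split in `restrict`.
  induced : Subset n → Subgraph G
  induced A = record
    { vertices  = A
    ; edges     = record
      { Adj        = λ u v → Adj u v × lookup A u ≡ true × lookup A v ≡ true
      ; adj?       = λ u v → adj? u v ×-dec (lookup A u Bool.≟ true) ×-dec (lookup A v Bool.≟ true)
      ; adj-sym    = λ (uv , u∈A , v∈A) → adj-sym uv , v∈A , u∈A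
      ; adj-irrefl = λ u≡v (uv , _) → adj-irrefl u≡v uv
      }
    ; edges⊆G   = proj₁
    ; endpoint∈ = λ {u} (_ , u∈A , _) → lookup⇒[]= u A u∈A
    }

  induced-degree : ∀ A {v} → v ∈ A →
    ι (Subgraph.degree (induced A) v) ≡ ∑[ u < n ] (adjacency v u * χ A u)
  induced-degree A {v} v∈A = trans (∣A∣≡sum-χ (Graph.neighbours H v)) (sum-cong-≗ λ u →
    trans (cong ⟦_⟧ (lookup∘tabulate (does ∘ Graph.adj? H v) u))
      (trans (restrict u) (cong (_* χ A u) (sym (adjacency≡ v u)))))
    where
    H = Subgraph.edges (induced A)
    restrict : ∀ u → ⟦ does (Graph.adj? H v u) ⟧ ≡ ⟦ does (adj? v u) ⟧ * χ A u
    restrict u rewrite []=⇒lookup v∈A with does (adj? v u) | lookup A u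
    ... | true  | true  = refl
    ... | true  | false = refl
    ... | false | true  = refl
    ... | false | false = refl

  -- Each neighbour of `v` is counted exactly once, in `A` or in its complement.
  induced-degree-∁ : ∀ A {v} → v ∉ A →
    ι (Subgraph.degree (induced (∁ A)) v) ≡ ι (degree v) - ∑[ u < n ] (adjacency v u * χ A u)
  induced-degree-∁ A {v} v∉A = trans
    (solve 2 (λ d s → d := d :+ s :- s) refl (ι (Subgraph.degree (induced (∁ A)) v)) S)
    (cong (_- S) (begin
      ι (Subgraph.degree (induced (∁ A)) v) + S
        ≡⟨ cong (λ e → e + S) (induced-degree (∁ A) (x∉p⇒x∈∁p v∉A)) ⟩
      ∑[ u < n ] (adjacency v u * χ (∁ A) u) + S
        ≡⟨ sym (∑-distrib-+ (λ u → adjacency v u * χ (∁ A) u) (λ u → adjacency v u * χ A u)) ⟩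
      ∑[ u < n ] (adjacency v u * χ (∁ A) u + adjacency v u * χ A u)
        ≡⟨ sum-cong-≗ (λ u → trans (sym (ℚ.*-distribˡ-+ (adjacency v u) (χ (∁ A) u) (χ A u)))
             (trans (cong (adjacency v u *_) (χ-∁ u)) (ℚ.*-identityʳ (adjacency v u)))) ⟩
      sum (adjacency v)
        ≡⟨ sym (∣A∣≡sum-χ (neighbours v)) ⟩
      ι (degree v) ∎))
    where
    open ≡-Reasoning
    S = ∑[ u < n ] (adjacency v u * χ A u)
    χ-∁ : ∀ u → χ (∁ A) u + χ A u ≡ 1ℚ
    χ-∁ u rewrite lookup-map u not A with lookup A u
    ... | true  = refl
    ... | false = refl

  -- From surplus bounds to relative fullness

  module _ (em : ExcludedMiddle 0ℓ) (q : ℝ) where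

    private
      -- One `p` serves both sides: its closeness to `q` gives `q`-fullness, its membership in the
      -- cut of `q` gives `(1 - q)`-fullness.
      approximation = determining-≤ q em n
      p = proj₁ approximation

    threshold : Fin n → ℚ
    threshold v = ι (degree v) * p

    open Surplus adjacency threshold

    deficit-free⇒full : ∀ {k} →
      (∃[ A ] ∣ A ∣ ≡ k × Deficit-free A) → HasRelativelyFull G q k
    deficit-free⇒full (A , ∣A∣≡k , h) = induced A , ∣A∣≡k , λ v v∈A →
      proj₂ (proj₂ approximation) (∣p∣≤n (neighbours v))
        (∣p∣≤n (Graph.neighbours (Subgraph.edges (induced A)) v))
        (subst (threshold v ≤_) (sym (induced-degree A v∈A)) (0≤q-p⇒p≤q (h v v∈A)))

    excess-free⇒full : ∀ {l} →
      (∃[ A ] n ∸ ∣ A ∣ ≡ l × Excess-free A) → HasRelativelyFull G (1ℝ -ℝ q) l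
    excess-free⇒full (A , n∸∣A∣≡l , h) =
      induced (∁ A) , trans (∣∁p∣≡n∸∣p∣ A) n∸∣A∣≡l , λ v v∈∁A →
      let v∉A = x∈∁p⇒x∉p v∈∁A
          S = ∑[ u < n ] (adjacency v u * χ A u)
      in 1-·-≤ℝ q (degree v) (proj₁ (proj₂ approximation))
        (subst (ι (degree v) * (1ℚ - p) ≤_) (sym (induced-degree-∁ A v∉A))
          (≤-by (solve 3 (λ d p s → con 0ℚ :- (s :- d :* p) := d :- s :- d :* (con 1ℚ :- p))
                   refl (ι (degree v)) p S)
                (h v v∉A)))

    full-trichotomy : ∀ {k l} → k ℕ.+ l ≡ n →
      HasRelativelyFull G q k
      ⊎ HasRelativelyFull G (1ℝ -ℝ q) l
      ⊎ (HasRelativelyFull G q (suc k) × HasRelativelyFull G (1ℝ -ℝ q) (suc l))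
    full-trichotomy {k} {l} k+l≡n =
      Sum.map deficit-free⇒full
        (Sum.map (excess-free⇒full ∘ complement-size k+l≡n)
          (λ (A , B) → deficit-free⇒full A , excess-free⇒full (complement-size⁺ B)))
        (surplus-trichotomy adjacency threshold adjacency-sym adjacency-diag adjacency≥0
          (subst (k ℕ.≤_) k+l≡n (ℕ.m≤m+n k l)))
      where
      complement-size : ∀ {j i} {P : Subset n → Set} → j ℕ.+ i ≡ n →
        ∃[ A ] ∣ A ∣ ≡ j × P A → ∃[ A ] n ∸ ∣ A ∣ ≡ i × P A
      complement-size {j} {i} j+i≡n (A , refl , pA) =
        A , trans (cong (_∸ j) (sym j+i≡n)) (ℕ.m+n∸m≡n j i) , pA
      complement-size⁺ : ∀ {P : Subset n → Set} →
        ∃[ A ] suc ∣ A ∣ ≡ k × P A → ∃[ A ] n ∸ ∣ A ∣ ≡ suc l × P A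
      complement-size⁺ (A , refl , pA) =
        -- The vertex removed from the set of size `k` moves to the complement, which grows to
        -- `suc l`.
        complement-size (trans (ℕ.+-suc ∣ A ∣ l) k+l≡n) (A , refl , pA)

theorem7 : ExcludedMiddle 0ℓ →
    ∀ (n : ℕ) (G : Graph n) (q : ℝ) → 0ℝ ≤ℝ q → q ≤ℝ 1ℝ →
    ∀ (k l : ℕ) → IsCeiling (n · q) (+ k) → IsFloor (n · (1ℝ -ℝ q)) (+ l) →
    HasRelativelyFull G q k
    ⊎ HasRelativelyFull G (1ℝ -ℝ q) l
    ⊎ (HasRelativelyFull G q (suc k) × HasRelativelyFull G (1ℝ -ℝ q) (suc l))
theorem7 em n G q _ _ k l k-ceil l-floor =
  full-trichotomy G em q (ceiling+floor q k-ceil l-floor)
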